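{- Let $G=(V,E)$ be a time-dependent network: a directed graph in which each edge $e\in E$ carries a piecewise linear travel-time function $f_e:\mathbb{R}\to\mathbb{R}$, where $f_e(\tau)$ is the time needed to traverse $e$ when departing at time $\tau$, with the FIFO property $\tau+f_e(\tau)\le\tau'+f_e(\tau')$ for all $\tau<\tau'$. Let the nodes of $V$ be ordered (by importance), and let the time-dependent contraction hierarchy (TCH) of $G$ be constructed by contracting the nodes in this order, as described in the context. Then the TCH query algorithm described in the context is correct: for a query consisting of a source $s$, a destination $t$ and a departure time $\tau_0$, the forward search from $s$ with departure time $\tau_0$ in $(V,E_\uparrow\cup E_{\mathrm{marked}})$ finds a shortest path from $s$ to $t$, i.e., one of minimum travel time from $s$ to $t$ for departure time $\tau_0$.
   Context: **Travel times.** The chaining $f*g$ of travel-time functions (first $f$, then $g$) is $(f*g)(\tau)=f(\tau)+g(\tau+f(\tau))$. The travel-time function of a path is the chaining of the functions of its edges in order. A path is shortest at departure time $\tau$ if its travel time at $\tau$ is minimum among all paths with the same endpoints. **Construction of the TCH.** The first overlay graph is $G$ itself, and the nodes are contracted one after another in the given order. When node $v$ is contracted, there is a current time-dependent overlay graph $G'=(V',E')$ with $v\in V'$; write $c$ for its edge weight functions. The next overlay graph is $G''=(V'\setminus\{v\},E'')$, which retains the edges of $G'$ not incident to $v$. For every combination of an incoming edge $(u,v)\in E'$ and an outgoing edge $(v,w)\in E'$, it is decided whether the path $\langle u,v,w\rangle$ may be a shortest path at any point in time. If so, the shortcut edge $(u,w)$ is inserted into $G''$, with weight function the chaining $c((u,v)*(v,w))$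 of the weight functions of $(u,v)$ and $(v,w)$. The decision is made by a profile search from $u$ (a Dijkstra-like search whose labels are travel-time functions): the shortcut is needed if $c((u,v)*(v,w))<d(u,w)$ at any point in time, where $d(u,w)$ is the function giving, for each departure time, the minimum travel time from $u$ to $w$ in $G'$ over the paths competing with $\langle u,v,w\rangle$, namely those avoiding $v$. Afterwards, a shortcut is considered only during the time intervals in which it may represent a shortest path; at departure times outside these intervals it is ignored (and searches never wait at a node for a shortcut to become valid). The TCH consists of the node set $V$ and all edges of $G$ together with all inserted shortcuts. **Upward and downward graph.** $G_\uparrow=(V,E_\uparrow)$ consists of the TCH edges leading from a node to a node later in the order (contracted later, more important). $G_\downarrow$ consists of the TCH edges leading from a node to a node earlier in the order. **Query.** Given $s$, $t$ and $\tau_0$: (1) explore all nodes that can reach $t$ in $G_\downarrow$, ignoring edge weights, and mark all edges of $G_\downarrow$ connecting nodes that can reach $t$; $E_{\mathrm{marked}}$ is the set of marked edges. (2) Perform a forward search from $s$ in $(V,E_\uparrow\cup E_{\mathrm{marked}})$ by time-dependent Dijkstra with departure time $\tau_0$, that is, Dijkstra's algorithm in which the weight of each relaxed edge is evaluated at the arrival time at its tail node. A path found in the TCH represents the path in $G$ obtained by repeatedly replacing each shortcut $(u,w)$ by the two edges $(u,v),(v,w)$ it was built from. -}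

module Defs where

open import Algebra.Bundles using (CommutativeRing)
open import Axiom.ExcludedMiddle using (ExcludedMiddle)
open import Data.Bool.Base using (Bool; T; if_then_else_)
open import Data.Bool.Properties using (T?)
open import Data.Empty using (⊥)
open import Data.Fin.Base as Fin using (Fin)
open import Data.Fin.Permutation using (Permutation′; _⟨$⟩ʳ_; _⟨$⟩ˡ_)
import Data.Fin.Properties as Fin
open import Data.List.Base using (List; []; _∷_; _++_; foldl; filter; tabulate; allFin; cartesianProductWith)
open import Data.List.Membership.Propositional using (_∈_)
open import Data.Maybe.Base as Maybe using (Maybe; just; nothing)
open import Data.Nat.Base using (ℕ; zero; suc)
open import Data.Product.Base using (Σ; ∃; ∃-syntax; _×_; _,_)
open import Data.Sum.Base using (_⊎_)
open import Data.Unit.Base using (⊤)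
open import Function.Base using (id)
open import Level using (0ℓ)
open import Relation.Binary.Construct.Closure.ReflexiveTransitive using (Star; ε; _◅_; _◅◅_; kleisliStar)
import Relation.Binary.Construct.NonStrictToStrict as ToStrict
open import Relation.Binary.Core using (Rel)
open import Relation.Binary.PropositionalEquality.Core using (_≡_; refl; _≢_)
open import Relation.Binary.Structures using (IsTotalOrder)
open import Relation.Nullary.Decidable.Core using (Dec; yes; no; does; ¬?; _⊎-dec_)
open import Relation.Nullary.Negation.Core using (¬_)

-- The real numbers, given axiomatically as a Dedekind-complete ordered field.
-- Equality is a setoid equality, so that (say) regular Cauchy sequences of
-- rationals are a possible carrier.
record Reals : Set₁ where
  field
    commutativeRing : CommutativeRing 0ℓ 0ℓ
  open CommutativeRing commutativeRing public
    using (Carrier; _≈_; _+_; _*_; -_; 0#; 1#; isCommutativeRing)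
  infix 4 _≤_
  field
    _≤_          : Rel Carrier 0ℓ
    isTotalOrder : IsTotalOrder _≈_ _≤_
    0≉1          : ¬ 0# ≈ 1#
    inverse      : ∀ x → ¬ x ≈ 0# → ∃[ y ] x * y ≈ 1#
    +-monoˡ-≤    : ∀ z {x y} → x ≤ y → x + z ≤ y + z
    *-nonneg     : ∀ {x y} → 0# ≤ x → 0# ≤ y → 0# ≤ x * y
  UpperBound : (Carrier → Set) → Carrier → Set
  UpperBound P b = ∀ x → P x → x ≤ b
  field
    supremum : (P : Carrier → Set) → ∃ P → ∃ (UpperBound P) →
               ∃[ b ] UpperBound P b × (∀ b′ → UpperBound P b′ → b ≤ b′)
  open ToStrict _≈_ _≤_ public using (_<_)

module _ (ℝ : Reals) where
  open Reals ℝ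

  -- Jumps at the finitely many breakpoints inside a bounded interval are not
  -- excluded here; FIFO still restricts them.
  data PiecewiseLinearOn (f : Carrier → Carrier) : Carrier → Carrier → Set where
    linear : ∀ {a b} m q → (∀ x → a < x → x < b → f x ≈ m * x + q) →
             PiecewiseLinearOn f a b
    split  : ∀ {a b c} → a < b → b < c →
             PiecewiseLinearOn f a b → PiecewiseLinearOn f b c →
             PiecewiseLinearOn f a c

  record IsTravelTimeFunction (f : Carrier → Carrier) : Set where
    field
      cong            : ∀ {τ τ′} → τ ≈ τ′ → f τ ≈ f τ′
      piecewiseLinear : ∀ a b → a < b → PiecewiseLinearOn f a b
      nonneg          : ∀ τ → 0# ≤ f τ
      fifo            : ∀ τ τ′ → τ < τ′ → τ + f τ ≤ τ′ + f τ′

  record TimeDependentNetwork : Set where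
    field
      size       : ℕ
      hasEdge    : Fin size → Fin size → Bool
      travelTime : ∀ {u w} → T (hasEdge u w) → Carrier → Carrier
      isTTF      : ∀ {u w} (e : T (hasEdge u w)) → IsTravelTimeFunction (travelTime e)

-- Travel times, and paths in the network itself.

module Network (ℝ : Reals) (G : TimeDependentNetwork ℝ) where
  open Reals ℝ
  open TimeDependentNetwork G public renaming (travelTime to edgeTime)

  V : Set
  V = Fin size

  Time : Set
  Time = Carrier

  infixr 6 _⊛_
  _⊛_ : (Time → Time) → (Time → Time) → Time → Time
  (f ⊛ g) τ = f τ + g (τ + f τ)

  pathTime : {A : V → V → Set} → (∀ {u w} → A u w → Time → Time) →
             ∀ {u w} → Star A u w → Time → Time
  pathTime c ε       = λ _ → 0#
  pathTime c (a ◅ p) = c a ⊛ pathTime c p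

  Edge : V → V → Set
  Edge u w = T (hasEdge u w)

  Path : V → V → Set
  Path = Star Edge

  IsShortestAt : ∀ {u w} → Time → Path u w → Set
  IsShortestAt {u} {w} τ p = ∀ (q : Path u w) → pathTime edgeTime p τ ≤ pathTime edgeTime q τ

  -- An arc is an edge of G or a shortcut, which remembers the two arcs it
  -- was built from.  Arcs with the same endpoints are kept as parallel arcs.
  data Arc : V → V → Set where
    edge     : ∀ {u w} → Edge u w → Arc u w
    shortcut : ∀ {u v w} → Arc u v → Arc v w → Arc u w

  weight : ∀ {u w} → Arc u w → Time → Time
  weight (edge e)       = edgeTime e
  weight (shortcut a b) = weight a ⊛ weight b

  unpack : ∀ {u w} → Arc u w → Path u w
  unpack (edge e)       = e ◅ ε
  unpack (shortcut a b) = unpack a ◅◅ unpack b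

  represented : ∀ {u w} → Star Arc u w → Path u w
  represented = kleisliStar id unpack

  -- The (finite) arc set of a multigraph on V.
  Arcs : Set
  Arcs = ∀ u w → List (Arc u w)

-- Excluded middle is used to turn the comparisons of real numbers and of
-- functions made by the algorithms into decisions.  The node contracted in
-- round i is order ⟨$⟩ʳ i.

module Hierarchy (em : ExcludedMiddle 0ℓ) (ℝ : Reals) (G : TimeDependentNetwork ℝ)
                 (order : Permutation′ (TimeDependentNetwork.size G)) where
  open Reals ℝ
  open Network ℝ G public

  -- 'active a τ' says that arc a is considered at departure time τ.
  -- Contracted nodes are isolated in 'overlay'.
  record Stage : Set₁ where
    field
      overlay   : Arcs
      hierarchy : Arcs
      active    : ∀ {u w} → Arc u w → Time → Set

  initial : Stage
  initial = record { overlay = edges ; hierarchy = edges ; active = isEdge }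
    where
    edges : Arcs
    edges u w with T? (hasEdge u w)
    ... | yes e = edge e ∷ []
    ... | no  _ = []

    isEdge : ∀ {u w} → Arc u w → Time → Set
    isEdge (edge _)       _ = ⊤
    isEdge (shortcut _ _) _ = ⊥

  module Contraction (S : Stage) (v : V) where
    open Stage S

    Usable : ∀ {u w} → Star Arc u w → Time → Set
    Usable         ε       τ = ⊤
    Usable {u = u} (_◅_ {j = x} a p) τ =
      a ∈ overlay u x × active a τ × Usable p (τ + weight a τ)

    Avoids : ∀ {u w} → Star Arc u w → Set
    Avoids {u} ε       = u ≢ v
    Avoids {u} (_ ◅ p) = u ≢ v × Avoids p

    -- d(u,w)(τ) is the minimum of pathTime weight p τ over the competing
    -- paths p, and is ∞ if there is none.  Thus x < d(u,w)(τ) means that x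
    -- is less than the travel time of each competing path; likewise for ≤.
    Competing : ∀ {u w} → Star Arc u w → Time → Set
    Competing p τ = Usable p τ × Avoids p

    _<d[_,_]_ : Time → V → V → Time → Set
    x <d[ u , w ] τ = ∀ (p : Star Arc u w) → Competing p τ → x < pathTime weight p τ

    _≤d[_,_]_ : Time → V → V → Time → Set
    x ≤d[ u , w ] τ = ∀ (p : Star Arc u w) → Competing p τ → x ≤ pathTime weight p τ

    Needed : ∀ {u w} → Arc u w → Set
    Needed {u} {w} a = ∃[ τ ] weight a τ <d[ u , w ] τ

    incident? : ∀ u w → Dec (u ≡ v ⊎ w ≡ v)
    incident? u w = (u Fin.≟ v) ⊎-dec (w Fin.≟ v)

    inserted : Arcs
    inserted u w =
      if does (incident? u w) then []
      else filter (λ a → em {Needed a})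
                  (cartesianProductWith shortcut (overlay u v) (overlay v w))

    retained : Arcs
    retained u w = if does (incident? u w) then [] else overlay u w

    -- A path tying with the best competing path is also a shortest path, so
    -- an inserted shortcut is active when its weight is ≤ d, not only when
    -- it is < d.  Its weight is the chained function, defined at all times;
    -- activity restricts the competing paths, through 'Usable', but not the
    -- two constituents of the shortcut.
    contract : Stage
    contract = record
      { overlay   = λ u w → retained u w ++ inserted u w
      ; hierarchy = λ u w → hierarchy u w ++ inserted u w
      ; active    = λ {u} {w} a τ →
          active a τ ⊎ (a ∈ inserted u w × weight a τ ≤d[ u , w ] τ)
      }

  final : Stage
  final = foldl Contraction.contract initial (tabulate (order ⟨$⟩ʳ_))

  open Stage final public using () renaming (hierarchy to TCH; active to Active)

  rank : V → Fin size
  rank v = order ⟨$⟩ˡ v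

  Down : V → V → Set
  Down u w = rank w Fin.< rank u × ∃[ a ] a ∈ TCH u w

  Up : V → V → Set
  Up u w = rank u Fin.< rank w × ∃[ a ] a ∈ TCH u w

  Marked : V → V → V → Set
  Marked t u w = Down u w × Star Down u t × Star Down w t

  -- E↑ ∪ E_marked.
  searchArcs : V → Arcs
  searchArcs t u w = if does (em {Up u w ⊎ Marked t u w}) then TCH u w else []

  -- Time-dependent Dijkstra.

  module Dijkstra (arcs : Arcs) (s : V) (τ₀ : Time) where

    record Label (v : V) : Set where
      constructor label
      field
        arrival : Time
        path    : Star Arc s v
    open Label public

    Labels : Set
    Labels = ∀ v → Maybe (Label v)

    better : ∀ {v} → Label v → Maybe (Label v) → Label v
    better new nothing    = new
    better new (just old) =
      if does (em {arrival new < arrival old}) then new else old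

    relax : ∀ {u w} → Label u → Maybe (Label w) → Arc u w → Maybe (Label w)
    relax (label τ p) l a =
      if does (em {Active a τ})
      then just (better (label (τ + weight a τ) (p ◅◅ a ◅ ε)) l)
      else l

    relaxAll : ∀ {u} → Label u → Labels → Labels
    relaxAll {u} lu ls w = foldl (relax lu) (ls w) (arcs u w)

    -- The labelled node of earliest arrival among the given nodes.
    closest : Labels → List V → Maybe (Σ V Label)
    closest ls []       = nothing
    closest ls (v ∷ vs) with ls v | closest ls vs
    ... | nothing | best           = best
    ... | just l  | nothing        = just (v , l)
    ... | just l  | just (v′ , l′) =
      if does (em {arrival l ≤ arrival l′}) then just (v , l) else just (v′ , l′)

    -- The first argument bounds the number of rounds; since every round
    -- settles one node, 'size' rounds empty the queue.
    run : ℕ → List V → Labels → Labels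
    run zero    unsettled ls = ls
    run (suc k) unsettled ls with closest ls unsettled
    ... | nothing       = ls
    ... | just (u , lu) = run k (filter (λ v → ¬? (v Fin.≟ u)) unsettled) (relaxAll lu ls)

    start : Labels
    start v with s Fin.≟ v
    ... | yes refl = just (label τ₀ ε)
    ... | no  _    = nothing

    search : ∀ t → Maybe (Star Arc s t)
    search t = Maybe.map path (run size (allFin size) start t)

  query : ∀ s t → Time → Maybe (Star Arc s t)
  query s t τ₀ = Dijkstra.search (searchArcs t) s τ₀ t

{-# OPTIONS --safe #-}
module Submission where

open import Algebra.Bundles using (CommutativeRing)
open import Axiom.ExcludedMiddle using (ExcludedMiddle)
open import Data.Bool.Properties using (T?; T-irrelevant)
open import Data.Empty using (⊥; ⊥-elim)
open import Data.Fin.Base as Fin using (Fin)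
import Data.Fin.Properties as Fin
open import Data.Fin.Induction using (spo-wellFounded)
open import Data.Fin.Permutation using (Permutation′; _⟨$⟩ʳ_; inverseˡ; inverseʳ)
open import Data.List.Base using (List; []; _∷_; foldl; filter; tabulate; allFin; length)
open import Data.List.Membership.Propositional using (_∈_; _∉_)
open import Data.List.Membership.Propositional.Properties
open import Data.List.Properties using (filter-notAll; length-tabulate)
import Data.List.Relation.Unary.All as All
open import Data.List.Relation.Unary.All using (All)
open import Data.List.Relation.Unary.AllPairs using (AllPairs; []; _∷_)
import Data.List.Relation.Unary.AllPairs.Properties as AllPairs
open import Data.List.Relation.Unary.Any using (here; there)
import Data.List.Relation.Unary.Any as Any
open import Data.Maybe.Base using (Maybe; just; nothing)
import Data.Maybe.Relation.Unary.All as Maybe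
open import Data.Nat.Base as ℕ using (ℕ; zero; suc)
import Data.Nat.Properties as ℕ
open import Data.Product.Base using (Σ; ∃; ∃-syntax; _×_; _,_; proj₁; proj₂)
open import Data.Sum.Base using (_⊎_; inj₁; inj₂; [_,_]′)
open import Data.Unit.Base using (tt)
open import Function.Base using (_∘_; id)
open import Induction.WellFounded using (WellFounded; Acc; acc)
open import Level using (0ℓ)
open import Relation.Binary.Construct.Closure.ReflexiveTransitive using (Star; ε; _◅_; _◅◅_)
import Relation.Binary.Construct.NonStrictToStrict as ToStrict
open import Relation.Binary.PropositionalEquality as ≡ using (_≡_; _≢_; refl; subst)
open import Relation.Binary.Structures using (IsTotalOrder)
open import Relation.Nullary.Decidable.Core using (yes; no; ¬?; decidable-stable)
open import Relation.Nullary.Negation.Core using (¬_; contradiction)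
open import Defs

-- Call an arc tight if it leads from the earliest arrival at its tail to the earliest
-- arrival at its head.  Every reachable node is reached from s by tight edges.  This is
-- preserved by contractions if one allows, besides the overlay arcs, upward arcs out of
-- contracted nodes and downward arcs into contracted nodes from which t is reached
-- downward.  Indeed, a tight detour x → v → y through the contracted node v becomes a tight
-- shortcut, or else some competing path from x arrives at y no later.  That path may visit
-- nodes later than necessary, so that it cannot be used as it is: a node whose earliest
-- arrival is before that at the target is treated by induction on the earliest arrival,
-- and FIFO makes the path tight at the other nodes.  An arc of the hierarchy is active
-- whenever it is optimal, in particular when it is tight, so activity restricts no tight
-- arc.  After the last contraction t is reached by tight arcs of the search graph, and
-- Dijkstra's algorithm is exact at all nodes so reached.

-- Order arithmetic of the reals, and minima of finite unions.

module OrderedField (em : ExcludedMiddle 0ℓ) (ℝ : Reals) where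
  open Reals ℝ
  open CommutativeRing commutativeRing public
    using (+-cong; +-congˡ; +-congʳ; +-assoc; +-comm; +-identityˡ; +-identityʳ; -‿inverseˡ)
    renaming (refl to ≈-refl; sym to ≈-sym; trans to ≈-trans)
  open IsTotalOrder isTotalOrder public
    using (total; antisym; reflexive; isPartialOrder)
    renaming (refl to ≤-refl; trans to ≤-trans; ≤-respˡ-≈ to ≤-respˡ; ≤-respʳ-≈ to ≤-respʳ)

  <-trans : ∀ {x y z} → x < y → y < z → x < z
  <-trans = ToStrict.<-trans _≈_ _≤_ isPartialOrder

  <-resp-≈ : ∀ {x x′ y y′} → x ≈ x′ → y ≈ y′ → x < y → x′ < y′
  <-resp-≈ x≈x′ y≈y′ (x≤y , x≉y) =
    ≤-respˡ x≈x′ (≤-respʳ y≈y′ x≤y) ,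
    λ x′≈y′ → x≉y (≈-trans x≈x′ (≈-trans x′≈y′ (≈-sym y≈y′)))

  ≮⇒≥ : ∀ {x y} → ¬ x < y → y ≤ x
  ≮⇒≥ = ToStrict.≮⇒≥ _≈_ _≤_ ≈-sym (λ _ _ → em) reflexive total

  ≰⇒≥ : ∀ {x y} → ¬ x ≤ y → y ≤ x
  ≰⇒≥ {x} {y} x≰y with total x y
  ... | inj₁ x≤y = contradiction x≤y x≰y
  ... | inj₂ y≤x = y≤x

  +-monoʳ-≤ : ∀ z {x y} → x ≤ y → z + x ≤ z + y
  +-monoʳ-≤ z {x} {y} x≤y =
    ≤-respˡ (+-comm x z) (≤-respʳ (+-comm y z) (+-monoˡ-≤ z x≤y))

  x≤x+y : ∀ {x y} → 0# ≤ y → x ≤ x + y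
  x≤x+y {x} 0≤y = ≤-respˡ (+-identityʳ x) (+-monoʳ-≤ x 0≤y)

  -x+[x+y]≈y : ∀ x y → - x + (x + y) ≈ y
  -x+[x+y]≈y x y = ≈-trans (≈-sym (+-assoc (- x) x y))
    (≈-trans (+-congʳ (-‿inverseˡ x)) (+-identityˡ y))

  +-cancelˡ-≤ : ∀ x {y z} → x + y ≤ x + z → y ≤ z
  +-cancelˡ-≤ x {y} {z} le =
    ≤-respˡ (-x+[x+y]≈y x y) (≤-respʳ (-x+[x+y]≈y x z) (+-monoʳ-≤ (- x) le))

  HasMinimum : (Carrier → Set) → Set
  HasMinimum X = ∃[ m ] X m × (∀ x → X x → m ≤ x)

  -- Excluded middle decides which members are inhabited; the minimum of the head is then compared
  -- with that of the rest. A minimum is asked of inhabited members only, since a pair of nodes may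
  -- offer no exit edge in the later use.
  finiteUnion-hasMinimum : ∀ {n} (X : Fin n → Carrier → Set) →
    (∀ i → ∃ (X i) → HasMinimum (X i)) →
    ∃ (λ x → ∃[ i ] X i x) → HasMinimum (λ x → ∃[ i ] X i x)
  finiteUnion-hasMinimum {zero} X _ (_ , () , _)
  finiteUnion-hasMinimum {suc n} X min (x , i , Xix)
    with em {∃ (X Fin.zero)} | em {∃ (λ x → ∃[ j ] X (Fin.suc j) x)}
  ... | no ∄₀ | no ∄₊ = ⊥-elim (absurd i Xix)
    where
    absurd : ∀ i → ¬ X i x
    absurd Fin.zero    Xx = ∄₀ (x , Xx)
    absurd (Fin.suc i) Xx = ∄₊ (x , i , Xx)
  ... | yes ∃₀ | no ∄₊ with min Fin.zero ∃₀
  ...   | m , Xm , m≤ = m , (Fin.zero , Xm) , λ where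
    x (Fin.zero  , Xx) → m≤ x Xx
    x (Fin.suc j , Xx) → contradiction (x , j , Xx) ∄₊
  finiteUnion-hasMinimum {suc n} X min _ | ∃₀? | yes ∃₊
    with finiteUnion-hasMinimum (X ∘ Fin.suc) (min ∘ Fin.suc) ∃₊
  finiteUnion-hasMinimum {suc n} X min _ | no ∄₀ | yes ∃₊ | m , (i , Xm) , m≤ =
    m , (Fin.suc i , Xm) , λ where
      x (Fin.zero  , Xx) → contradiction (x , Xx) ∄₀
      x (Fin.suc j , Xx) → m≤ x (j , Xx)
  finiteUnion-hasMinimum {suc n} X min _ | yes ∃₀ | yes ∃₊ | m , (i , Xm) , m≤
    with min Fin.zero ∃₀
  ... | m₀ , Xm₀ , m₀≤ with total m₀ m
  ...   | inj₁ m₀≤m = m₀ , (Fin.zero , Xm₀) , λ where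
    x (Fin.zero  , Xx) → m₀≤ x Xx
    x (Fin.suc j , Xx) → ≤-trans m₀≤m (m≤ x (j , Xx))
  ...   | inj₂ m≤m₀ = m , (Fin.suc i , Xm) , λ where
    x (Fin.zero  , Xx) → ≤-trans m≤m₀ (m₀≤ x Xx)
    x (Fin.suc j , Xx) → m≤ x (j , Xx)

-- FIFO functions and travel times of concatenated and unpacked paths.

module TravelTime (em : ExcludedMiddle 0ℓ) (ℝ : Reals) (G : TimeDependentNetwork ℝ) where
  open Reals ℝ
  open OrderedField em ℝ
  open Network ℝ G

  travel : ∀ {u w} → Path u w → Time → Time
  travel = pathTime {A = Edge} edgeTime

  -- The properties that pass from edges to shortcuts and paths under `_⊛_`. Stated with `≤`, `mono`
  -- can be applied to its own conclusion, as chaining does.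
  record IsFIFO (f : Time → Time) : Set where
    field
      cong   : ∀ {τ τ′} → τ ≈ τ′ → f τ ≈ f τ′
      nonneg : ∀ τ → 0# ≤ f τ
      mono   : ∀ {τ τ′} → τ ≤ τ′ → τ + f τ ≤ τ′ + f τ′

    arrival-cong : ∀ {τ τ′} → τ ≈ τ′ → τ + f τ ≈ τ′ + f τ′
    arrival-cong τ≈τ′ = +-cong τ≈τ′ (cong τ≈τ′)

  ⊛-arrival : ∀ f g τ → τ + (f ⊛ g) τ ≈ (τ + f τ) + g (τ + f τ)
  ⊛-arrival f g τ = ≈-sym (+-assoc τ (f τ) _)

  ⊛-isFIFO : ∀ {f g} → IsFIFO f → IsFIFO g → IsFIFO (f ⊛ g)
  ⊛-isFIFO {f} {g} F G = record
    { cong   = λ τ≈τ′ → +-cong (F.cong τ≈τ′) (G.cong (F.arrival-cong τ≈τ′))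
    ; nonneg = λ τ → ≤-trans (F.nonneg τ) (x≤x+y (G.nonneg _))
    ; mono   = λ {τ} {τ′} τ≤τ′ → ≤-respˡ (≈-sym (⊛-arrival f g τ))
                 (≤-respʳ (≈-sym (⊛-arrival f g τ′)) (G.mono (F.mono τ≤τ′)))
    }
    where
    module F = IsFIFO F
    module G = IsFIFO G

  0-isFIFO : IsFIFO (λ _ → 0#)
  0-isFIFO = record
    { cong = λ _ → ≈-refl ; nonneg = λ _ → ≤-refl ; mono = +-monoˡ-≤ 0# }

  edgeTime-isFIFO : ∀ {u w} (e : Edge u w) → IsFIFO (edgeTime e)
  edgeTime-isFIFO e = record { cong = E.cong ; nonneg = E.nonneg ; mono = mono }
    where
    module E = IsTravelTimeFunction (isTTF e)
    mono : ∀ {τ τ′} → τ ≤ τ′ → τ + edgeTime e τ ≤ τ′ + edgeTime e τ′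
    mono {τ} {τ′} τ≤τ′ with em {τ ≈ τ′}
    ... | yes τ≈τ′ = reflexive (+-cong τ≈τ′ (E.cong τ≈τ′))
    ... | no  τ≉τ′ = E.fifo τ τ′ (τ≤τ′ , τ≉τ′)

  weight-isFIFO : ∀ {u w} (a : Arc u w) → IsFIFO (weight a)
  weight-isFIFO (edge e)       = edgeTime-isFIFO e
  weight-isFIFO (shortcut a b) = ⊛-isFIFO (weight-isFIFO a) (weight-isFIFO b)

  module _ {A : V → V → Set} {c : ∀ {u w} → A u w → Time → Time}
           (isFIFO : ∀ {u w} (a : A u w) → IsFIFO (c a)) where

    pathTime-isFIFO : ∀ {u w} (p : Star A u w) → IsFIFO (pathTime c p)
    pathTime-isFIFO ε       = 0-isFIFO
    pathTime-isFIFO (a ◅ p) = ⊛-isFIFO (isFIFO a) (pathTime-isFIFO p)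

    pathTime-◅◅ : ∀ {u v w} (p : Star A u v) (q : Star A v w) τ →
                  pathTime c (p ◅◅ q) τ ≈ (pathTime c p ⊛ pathTime c q) τ
    pathTime-◅◅ ε       q τ = ≈-trans (IsFIFO.cong (pathTime-isFIFO q) (≈-sym (+-identityʳ τ)))
                                      (≈-sym (+-identityˡ _))
    pathTime-◅◅ (a ◅ p) q τ = ≈-trans (+-congˡ (pathTime-◅◅ p q _))
      (≈-trans (≈-sym (+-assoc _ _ _))
        (+-congˡ (IsFIFO.cong (pathTime-isFIFO q) (+-assoc _ _ _))))

    arrival-◅◅ : ∀ {u v w} (p : Star A u v) (q : Star A v w) τ →
                 τ + pathTime c (p ◅◅ q) τ ≈
                 (τ + pathTime c p τ) + pathTime c q (τ + pathTime c p τ)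
    arrival-◅◅ p q τ = ≈-trans (+-congˡ (pathTime-◅◅ p q τ)) (⊛-arrival (pathTime c p) (pathTime c q) τ)

  travel-isFIFO : ∀ {u w} (q : Path u w) → IsFIFO (travel q)
  travel-isFIFO = pathTime-isFIFO edgeTime-isFIFO

  travel-unpack : ∀ {u w} (a : Arc u w) τ → travel (unpack a) τ ≈ weight a τ
  travel-unpack (edge e)       τ = +-identityʳ _
  travel-unpack (shortcut a b) τ = ≈-trans (pathTime-◅◅ edgeTime-isFIFO (unpack a) (unpack b) τ)
    (+-cong (travel-unpack a τ)
      (≈-trans (travel-unpack b _)
        (IsFIFO.cong (weight-isFIFO b) (+-congˡ (travel-unpack a τ)))))

  travel-represented : ∀ {u w} (p : Star Arc u w) τ →
                         travel (represented p) τ ≈ pathTime weight p τ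
  travel-represented ε       τ = ≈-refl
  travel-represented (a ◅ p) τ =
    ≈-trans (pathTime-◅◅ edgeTime-isFIFO (unpack a) (represented p) τ)
      (+-cong (travel-unpack a τ)
        (≈-trans (travel-represented p _)
          (IsFIFO.cong (pathTime-isFIFO weight-isFIFO p) (+-congˡ (travel-unpack a τ)))))

-- Earliest arrivals, tight arcs and tight reachability.

module EarliestArrival (em : ExcludedMiddle 0ℓ) (ℝ : Reals) (G : TimeDependentNetwork ℝ)
                       (s : Fin (TimeDependentNetwork.size G)) (τ₀ : Reals.Carrier ℝ) where
  open Reals ℝ
  open OrderedField em ℝ
  open Network ℝ G
  open TravelTime em ℝ G

  -- A relation rather than a function: an unreachable node has no earliest arrival, and that the
  -- minimum over possibly infinitely many paths is attained has yet to be proved.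
  record Earliest (y : V) (σ : Time) : Set where
    field
      attained : ∃[ q ] τ₀ + travel {s} {y} q τ₀ ≈ σ
      minimal  : ∀ (q : Path s y) → σ ≤ τ₀ + travel q τ₀
  open Earliest public

  earliest-source : Earliest s τ₀
  earliest-source = record
    { attained = ε , +-identityʳ τ₀
    ; minimal  = λ q → x≤x+y (IsFIFO.nonneg (travel-isFIFO q) τ₀)
    }

  earliest-unique : ∀ {y σ σ′} → Earliest y σ → Earliest y σ′ → σ ≈ σ′
  earliest-unique E E′ = antisym
    (≤-respʳ (proj₂ (attained E′)) (minimal E (proj₁ (attained E′))))
    (≤-respʳ (proj₂ (attained E)) (minimal E′ (proj₁ (attained E))))

  earliest-resp-≈ : ∀ {y σ σ′} → σ ≈ σ′ → Earliest y σ → Earliest y σ′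
  earliest-resp-≈ σ≈σ′ E = record
    { attained = proj₁ (attained E) , ≈-trans (proj₂ (attained E)) σ≈σ′
    ; minimal  = λ q → ≤-respˡ σ≈σ′ (minimal E q)
    }

  earliest-path : ∀ {x y σ ρ} → Earliest x σ → Earliest y ρ →
                  (r : Path x y) → ρ ≤ σ + travel r σ
  earliest-path {σ = σ} {ρ} E F r with attained E
  ... | q , q≈σ = ≤-respʳ
    (≈-trans (arrival-◅◅ edgeTime-isFIFO q r τ₀) (IsFIFO.arrival-cong (travel-isFIFO r) q≈σ))
    (minimal F (q ◅◅ r))

  earliest-arc : ∀ {x y σ ρ} → Earliest x σ → Earliest y ρ →
                 (a : Arc x y) → ρ ≤ σ + weight a σ
  earliest-arc {σ = σ} E F a =
    ≤-respʳ (+-congˡ (travel-unpack a σ)) (earliest-path E F (unpack a))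

  Tight : ∀ {x y} → Arc x y → Set
  Tight {x} {y} a = ∃[ σ ] Earliest x σ × Earliest y (σ + weight a σ)

  tight-arrival : ∀ {x y σ} (a : Arc x y) → Tight a → Earliest x σ → Earliest y (σ + weight a σ)
  tight-arrival a (_ , E , F) E′ =
    earliest-resp-≈ (IsFIFO.arrival-cong (weight-isFIFO a) (earliest-unique E E′)) F

  -- A faster path, appended to an earliest path to the tail, would reach the head before its
  -- earliest arrival. This is what makes tight arcs active in the search.
  tight-optimal : ∀ {x y σ} (a : Arc x y) → Tight a → Earliest x σ →
                  (q : Path x y) → weight a σ ≤ travel q σ
  tight-optimal {σ = σ} a a-tight E q =
    +-cancelˡ-≤ σ (earliest-path E (tight-arrival a a-tight E) q)

  -- Chains grow at the far end, so that induction removes the last arc and never moves to a later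
  -- earliest arrival. The class `A` is left open: it changes from stage to stage, tightness does
  -- not.
  data Reaches (A : ∀ {x y} → Arc x y → Set) : V → Set where
    source : Reaches A s
    step   : ∀ {x y} → Reaches A x → (a : Arc x y) → A a → Tight a → Reaches A y

  reaches-earliest : ∀ {A : ∀ {x y} → Arc x y → Set} {y} → Reaches A y → ∃ (Earliest y)
  reaches-earliest source                   = τ₀ , earliest-source
  reaches-earliest (step _ _ _ (_ , _ , F)) = _ , F

  reaches-map : ∀ {A B : ∀ {x y} → Arc x y → Set} →
                (∀ {x y} {a : Arc x y} → A a → B a) → ∀ {y} → Reaches A y → Reaches B y
  reaches-map f source              = source
  reaches-map f (step r a Aa tight) = step (reaches-map f r) a (f Aa) tight

  IsEdge : ∀ {x y} → Arc x y → Set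
  IsEdge {x} {y} a = ∃[ e ] a ≡ edge {x} {y} e

  -- The least exit time is an earliest arrival, because every path from s to an
  -- unreached node leaves the set of reached nodes.
  Exit : V → V → Time → Set
  Exit x y τ = Reaches IsEdge x × ¬ Reaches IsEdge y ×
               Σ (Edge x y) λ e → ∃[ σ ] Earliest x σ × τ ≈ σ + edgeTime e σ

  -- For fixed `x` and `y` all exit times agree, because earliest arrivals are unique and so is the
  -- edge. What remains is a finite union over pairs of nodes.
  exit-hasMinimum : ∀ {τ} → ∃[ x ] ∃[ y ] Exit x y τ → HasMinimum (λ τ → ∃[ x ] ∃[ y ] Exit x y τ)
  exit-hasMinimum {τ} ex = finiteUnion-hasMinimum (λ x τ → ∃[ y ] Exit x y τ)
    (λ x → finiteUnion-hasMinimum (Exit x) λ y → λ where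
      (τ , Rx , ¬Ry , e , σ , E , τ≈) → τ , (Rx , ¬Ry , e , σ , E , τ≈) , λ where
        τ′ (_ , _ , e′ , σ′ , E′ , τ′≈) → reflexive (≈-trans τ≈
          (≈-trans (IsFIFO.arrival-cong (edgeTime-isFIFO e) (earliest-unique E E′))
            (≈-trans (reflexive-≡ (≡.cong (λ e → σ′ + edgeTime e σ′) (T-irrelevant e e′))) (≈-sym τ′≈)))))
    (τ , ex)
    where
    reflexive-≡ : ∀ {x y} → x ≡ y → x ≈ y
    reflexive-≡ refl = ≈-refl

  -- The first edge of `q` into an unreached node gives the exit. FIFO bounds the exit time by the
  -- arrival along `q`, and the remainder takes nonnegative time. The gap `σ ≤ τ` is carried because
  -- `q` may be late at the nodes it visits.
  leaves : ∀ {x w σ τ} → Reaches IsEdge x → Earliest x σ → σ ≤ τ → (q : Path x w) →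
           ¬ Reaches IsEdge w → ∃[ ρ ] (∃[ x ] ∃[ y ] Exit x y ρ) × ρ ≤ τ + travel q τ
  leaves Rx _ _ ε ¬Rw = contradiction Rx ¬Rw
  leaves {x} {σ = σ} {τ} Rx E σ≤τ (_◅_ {j = y} e q) ¬Rw with em {Reaches IsEdge y}
  ... | no ¬Ry = σ + edgeTime e σ , (x , y , Rx , ¬Ry , e , σ , E , ≈-refl) ,
    ≤-trans (IsFIFO.mono (edgeTime-isFIFO e) σ≤τ)
      (≤-respʳ (≈-sym (⊛-arrival (edgeTime e) (travel q) τ))
        (x≤x+y (IsFIFO.nonneg (travel-isFIFO q) _)))
  ... | yes Ry with reaches-earliest Ry
  ...   | σ′ , F with leaves Ry F
            (≤-trans (earliest-arc E F (edge e)) (IsFIFO.mono (edgeTime-isFIFO e) σ≤τ)) q ¬Rw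
  ...     | ρ , ex , ρ≤ = ρ , ex , ≤-respʳ (≈-sym (⊛-arrival (edgeTime e) (travel q) τ)) ρ≤

  -- Otherwise the edge realising the least exit time would be a tight edge into an unreached node.
  -- Through `reaches-earliest`, this also yields the existence of earliest arrivals.
  path⇒reaches : ∀ {w} → Path s w → Reaches IsEdge w
  path⇒reaches {w} q with em {Reaches IsEdge w}
  ... | yes Rw = Rw
  ... | no ¬Rw with leaves source earliest-source ≤-refl q ¬Rw
  ...   | ρ , ex , _ with exit-hasMinimum ex
  ...     | m , (x , y , Rx , ¬Ry , e , σ , E , m≈) , m≤ =
    contradiction (step Rx (edge e) (e , refl) (σ , E , earliest-resp-≈ m≈ F)) ¬Ry
    where
    F : Earliest y m
    F = record
      { attained = proj₁ (attained E) ◅◅ (e ◅ ε) ,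
          ≈-trans (arrival-◅◅ edgeTime-isFIFO (proj₁ (attained E)) (e ◅ ε) τ₀)
            (≈-trans (IsFIFO.arrival-cong (travel-isFIFO (e ◅ ε)) (proj₂ (attained E)))
              (≈-trans (+-congˡ (+-identityʳ _)) (≈-sym m≈)))
      ; minimal  = exit-minimal
      }
      where
      exit-minimal : ∀ r → m ≤ τ₀ + travel r τ₀
      exit-minimal r with leaves source earliest-source ≤-refl r ¬Ry
      ... | ρ′ , ex′ , ρ′≤ = ≤-trans (m≤ ρ′ ex′) ρ′≤

  _⊏_ : V → V → Set
  x ⊏ y = ∃[ σ ] ∃[ ρ ] Earliest x σ × Earliest y ρ × σ < ρ

  -- Real times admit infinite descent; it is the finiteness of `V` that makes this strict partial
  -- order well-founded.
  ⊏-wellFounded : WellFounded _⊏_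
  ⊏-wellFounded = spo-wellFounded {_≈_ = _≡_} record
    { isEquivalence = ≡.isEquivalence
    ; irrefl        = λ { refl (_ , _ , E , F , _ , σ≉ρ) → σ≉ρ (earliest-unique E F) }
    ; trans         = λ { (σ , ρ , E , F , σ<ρ) (σ′ , ρ′ , E′ , F′ , σ′<ρ′) →
        σ , ρ′ , E , F′ , <-trans σ<ρ (<-resp-≈ (earliest-unique E′ F) ≈-refl σ′<ρ′) }
    ; <-resp-≈      = (λ { refl x⊏y → x⊏y }) , (λ { refl x⊏y → x⊏y })
    }

-- The invariant of the contraction process.

module Contracting (em : ExcludedMiddle 0ℓ) (ℝ : Reals) (G : TimeDependentNetwork ℝ)
                   (order : Permutation′ (TimeDependentNetwork.size G))
                   (s t : Fin (TimeDependentNetwork.size G)) (τ₀ : Reals.Carrier ℝ) where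
  open Reals ℝ
  open OrderedField em ℝ
  open Hierarchy em ℝ G order
  open TravelTime em ℝ G
  open EarliestArrival em ℝ G s τ₀
  open Stage

  contractAll : List V → Stage → Stage
  contractAll vs S = foldl Contraction.contract S vs

  hierarchy⊆contractAll : ∀ vs S {x y} {a : Arc x y} →
                          a ∈ hierarchy S x y → a ∈ hierarchy (contractAll vs S) x y
  hierarchy⊆contractAll []       S a∈ = a∈
  hierarchy⊆contractAll (v ∷ vs) S a∈ =
    hierarchy⊆contractAll vs (Contraction.contract S v) (∈-++⁺ˡ a∈)

  Optimal : ∀ {x y} → Arc x y → Time → Set
  Optimal {x} {y} a τ = ∀ (q : Path x y) → weight a τ ≤ travel q τ

  ActiveWhenOptimal : Stage → Set
  ActiveWhenOptimal S = ∀ {x y} {a : Arc x y} {τ} →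
                        a ∈ hierarchy S x y → Optimal a τ → active S a τ

  initial-activeWhenOptimal : ActiveWhenOptimal initial
  initial-activeWhenOptimal {x} {y} a∈ _ with T? (hasEdge x y)
  initial-activeWhenOptimal (here refl) _ | yes e = tt

  -- A competing path represents a path of `G` with the same travel time, so a new shortcut that is
  -- optimal in `G` is no slower than its competitors. Activity gained earlier is never withdrawn.
  contractAll-activeWhenOptimal : ∀ vs S → ActiveWhenOptimal S → ActiveWhenOptimal (contractAll vs S)
  contractAll-activeWhenOptimal []       S act = act
  contractAll-activeWhenOptimal (v ∷ vs) S act =
    contractAll-activeWhenOptimal vs (Contraction.contract S v) contract-act
    where
    contract-act : ActiveWhenOptimal (Contraction.contract S v)
    contract-act {x} {y} {τ = τ} a∈ opt with ∈-++⁻ (hierarchy S x y) a∈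
    ... | inj₁ a∈old = inj₁ (act a∈old opt)
    ... | inj₂ a∈new = inj₂ (a∈new , λ p _ →
      ≤-respʳ (travel-represented p τ) (opt (represented p)))

  optimal⇒active : ActiveWhenOptimal final
  optimal⇒active = contractAll-activeWhenOptimal (tabulate (order ⟨$⟩ʳ_)) initial
                     initial-activeWhenOptimal

  -- `Up`, `Down` and `TCH` refer to the finished hierarchy, so `upward` and `downward` arcs stay
  -- admissible through later contractions. Once the overlay is empty, only arcs of the search graph
  -- remain.
  data Admissible (vs : List V) (S : Stage) {x y : V} (a : Arc x y) : Set where
    inOverlay : a ∈ overlay S x y → Admissible vs S a
    upward    : x ∉ vs → Up x y → a ∈ TCH x y → Admissible vs S a
    downward  : y ∉ vs → Down x y → Star Down y t → a ∈ TCH x y → Admissible vs S a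

  -- On the restriction of `w` in `reaches`: for a contracted node from which `t` is not reached
  -- downward, the incoming downward arcs are not admissible, so it may cease to be tightly
  -- reachable.
  record Invariant (vs : List V) (S : Stage) : Set where
    field
      overlay-vertices  : ∀ {x y} {a : Arc x y} → a ∈ overlay S x y → x ∈ vs × y ∈ vs
      overlay⊆hierarchy : ∀ {x y} {a : Arc x y} → a ∈ overlay S x y → a ∈ hierarchy S x y
      reaches           : ∀ {w} → Path s w → w ∈ vs ⊎ Star Down w t → Reaches (Admissible vs S) w

  initial-overlay : ∀ {x y} (e : Edge x y) → edge e ∈ overlay initial x y
  initial-overlay {x} {y} e with T? (hasEdge x y)
  ... | yes e′ rewrite T-irrelevant e e′ = here refl
  ... | no ¬e = contradiction e ¬e

  initial-invariant : ∀ {vs} → (∀ v → v ∈ vs) → Invariant vs initial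
  initial-invariant all∈ = record
    { overlay-vertices  = λ {x} {y} _ → all∈ x , all∈ y
    ; overlay⊆hierarchy = id
    ; reaches           = λ q _ → reaches-map (λ { (e , refl) → inOverlay (initial-overlay e) })
                                              (path⇒reaches q)
    }

  -- One contraction preserves the invariant.

  module ContractionStep (v : V) (vs : List V) (S : Stage)
    (v-lowest : All (λ w → rank v Fin.< rank w) vs)
    (inv : Invariant (v ∷ vs) S)
    (hierarchy⊆TCH : ∀ {x y} {a : Arc x y} → a ∈ hierarchy S x y → a ∈ TCH x y) where
    open Invariant inv
    open Contraction S v

    v∉vs : v ∉ vs
    v∉vs v∈vs = ℕ.<-irrefl refl (All.lookup v-lowest v∈vs)

    ≢v⇒∈vs : ∀ {x} → x ≢ v → x ∈ v ∷ vs → x ∈ vs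
    ≢v⇒∈vs x≢v (here x≡v)   = contradiction x≡v x≢v
    ≢v⇒∈vs x≢v (there x∈vs) = x∈vs

    ∉vs : ∀ {x} → x ∉ v ∷ vs → x ∉ vs
    ∉vs x∉ = x∉ ∘ there

    retained⁺ : ∀ {x y} {a : Arc x y} → x ≢ v → y ≢ v → a ∈ overlay S x y → a ∈ overlay contract x y
    retained⁺ {x} {y} x≢v y≢v a∈ with x Fin.≟ v | y Fin.≟ v
    ... | yes x≡v | _       = contradiction x≡v x≢v
    ... | no  _   | yes y≡v = contradiction y≡v y≢v
    ... | no  _   | no  _   = ∈-++⁺ˡ a∈

    inserted⁺ : ∀ {x y} {b : Arc x v} {a : Arc v y} → x ≢ v → y ≢ v →
                b ∈ overlay S x v → a ∈ overlay S v y → Needed (shortcut b a) →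
                shortcut b a ∈ inserted x y
    inserted⁺ {x} {y} x≢v y≢v b∈ a∈ needed with x Fin.≟ v | y Fin.≟ v
    ... | yes x≡v | _       = contradiction x≡v x≢v
    ... | no  _   | yes y≡v = contradiction y≡v y≢v
    ... | no  _   | no  _   =
      ∈-filter⁺ (λ a → em {Needed a}) (∈-cartesianProductWith⁺ shortcut b∈ a∈) needed

    contract-vertices : ∀ {x y} {a : Arc x y} → a ∈ overlay contract x y → x ∈ vs × y ∈ vs
    contract-vertices {x} {y} a∈ with x Fin.≟ v | y Fin.≟ v
    contract-vertices {x} {y} a∈ | no x≢v | no y≢v with ∈-++⁻ (overlay S x y) a∈
    ... | inj₁ a∈old =
      ≢v⇒∈vs x≢v (proj₁ (overlay-vertices a∈old)) , ≢v⇒∈vs y≢v (proj₂ (overlay-vertices a∈old))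
    ... | inj₂ a∈new with ∈-cartesianProductWith⁻ shortcut (overlay S x v) (overlay S v y)
                            (proj₁ (∈-filter⁻ (λ a → em {Needed a}) a∈new))
    ...   | b , c , b∈ , c∈ , _ =
      ≢v⇒∈vs x≢v (proj₁ (overlay-vertices b∈)) , ≢v⇒∈vs y≢v (proj₂ (overlay-vertices c∈))

    contract-overlay⊆hierarchy : ∀ {x y} {a : Arc x y} →
                                 a ∈ overlay contract x y → a ∈ hierarchy contract x y
    contract-overlay⊆hierarchy {x} {y} a∈ with ∈-++⁻ (retained x y) a∈
    ... | inj₂ a∈new = ∈-++⁺ʳ (hierarchy S x y) a∈new
    ... | inj₁ a∈old = ∈-++⁺ˡ (overlay⊆hierarchy (unretained a∈old))
      where
      unretained : ∀ {a : Arc x y} → a ∈ retained x y → a ∈ overlay S x y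
      unretained a∈ with x Fin.≟ v | y Fin.≟ v
      ... | no _ | no _ = a∈

    R′ : V → Set
    R′ = Reaches (Admissible vs contract)

    overlay-up : ∀ {y} {a : Arc v y} → y ≢ v → a ∈ overlay S v y → Admissible vs contract a
    overlay-up y≢v a∈ = upward v∉vs
      (All.lookup v-lowest (≢v⇒∈vs y≢v (proj₂ (overlay-vertices a∈))) , _ , a∈TCH) a∈TCH
      where a∈TCH = hierarchy⊆TCH (overlay⊆hierarchy a∈)

    overlay-down : ∀ {x} {a : Arc x v} → x ≢ v → a ∈ overlay S x v → Star Down v t →
                   Admissible vs contract a
    overlay-down x≢v a∈ v↓t = downward v∉vs
      (All.lookup v-lowest (≢v⇒∈vs x≢v (proj₁ (overlay-vertices a∈))) , _ , a∈TCH) v↓t a∈TCH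
      where a∈TCH = hierarchy⊆TCH (overlay⊆hierarchy a∈)

    -- A postponed decision: `v` itself may no longer be reachable, so the tight arc into it is
    -- remembered. It is either bypassed together with the next arc, or kept as a downward arc if
    -- `t` lies below `v`.
    record IntoContracted : Set where
      constructor into
      field
        {tail}  : V
        arc     : Arc tail v
        arc∈    : arc ∈ overlay S tail v
        tail≢v  : tail ≢ v
        reached : R′ tail
        tight   : Tight arc

    down-to-v : IntoContracted → Star Down v t → R′ v
    down-to-v (into b b∈ x≢v Rx b-tight) v↓t = step Rx b (overlay-down x≢v b∈ v↓t) b-tight

    -- `β` will be the earliest arrival at the node to be reached, and `earlier` the induction
    -- hypothesis along `_⊏_` in `contract-reaches`.
    module _ (β : Time) (earlier : ∀ {z σ} → z ∈ vs → Earliest z σ → σ < β → R′ z) where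

      -- A node with earliest arrival before β is reached by 'earlier'.  At any other node p
      -- arrives exactly at β, and FIFO makes the arc by which p enters it tight even if it
      -- is taken at the earliest arrival σ at its tail instead of the time ρ at which p is
      -- there (and although the rest of p need not be usable from σ onwards).
      follow : ∀ {z y} (p : Star Arc z y) {σ ρ} → R′ z → Earliest z σ → σ ≤ ρ →
               Usable p ρ → Avoids p → ρ + pathTime weight p ρ ≤ β → R′ y
      follow ε Rz _ _ _ _ _ = Rz
      follow (_◅_ {j = z′} a p) {σ} {ρ} Rz E σ≤ρ (a∈ , _ , usable) (z≢v , avoids) ρp≤β
        = next (reaches-earliest (reaches q (inj₁ (there z′∈vs))))
        where
        z′≢v : ∀ {z′ y} (p : Star Arc z′ y) → Avoids p → z′ ≢ v
        z′≢v ε       z′≢v       = z′≢v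
        z′≢v (_ ◅ _) (z′≢v , _) = z′≢v

        z′∈vs : z′ ∈ vs
        z′∈vs = ≢v⇒∈vs (z′≢v p avoids) (proj₂ (overlay-vertices a∈))

        q : Path s z′
        q = proj₁ (attained E) ◅◅ unpack a

        ρ′ = ρ + weight a ρ

        ρ′p≤β : ρ′ + pathTime weight p ρ′ ≤ β
        ρ′p≤β = ≤-respˡ (⊛-arrival (weight a) (pathTime weight p) ρ) ρp≤β

        ρ′≤β : ρ′ ≤ β
        ρ′≤β = ≤-trans (x≤x+y (IsFIFO.nonneg (pathTime-isFIFO weight-isFIFO p) ρ′)) ρ′p≤β

        next : ∃ (Earliest z′) → R′ _
        next (σ′ , F) = follow p Rz′ F σ′≤ρ′ usable avoids ρ′p≤β
          where
          σ+a≤ρ′ : σ + weight a σ ≤ ρ′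
          σ+a≤ρ′ = IsFIFO.mono (weight-isFIFO a) σ≤ρ

          σ′≤ρ′ : σ′ ≤ ρ′
          σ′≤ρ′ = ≤-trans (earliest-arc E F a) σ+a≤ρ′

          Rz′ : R′ z′
          Rz′ with em {σ′ < β}
          ... | yes σ′<β = earlier z′∈vs F σ′<β
          ... | no  σ′≮β = step Rz a (inOverlay (retained⁺ z≢v (z′≢v p avoids) a∈))
            (σ , E , earliest-resp-≈
              (antisym (earliest-arc E F a) (≤-trans σ+a≤ρ′ (≤-trans ρ′≤β (≮⇒≥ σ′≮β)))) F)

      bypass : ∀ {y σ} → IntoContracted → (a : Arc v y) → a ∈ overlay S v y → y ≢ v → Tight a →
               Earliest y σ → σ ≤ β → R′ y
      bypass {y} {σ} (into {x} b b∈ x≢v Rx b-tight@(_ , E , F)) a a∈ y≢v a-tight H σ≤β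
        with em {Needed (shortcut b a)}
      ... | yes needed = step Rx (shortcut b a)
        (inOverlay (∈-++⁺ʳ (retained x y) (inserted⁺ x≢v y≢v b∈ a∈ needed)))
        (_ , E , earliest-resp-≈ (≈-sym (⊛-arrival (weight b) (weight a) _)) (tight-arrival a a-tight F))
      ... | no unneeded with em {∃[ p ] Competing {x} {y} p (proj₁ b-tight) ×
                                  ¬ weight (shortcut b a) (proj₁ b-tight) < pathTime weight p (proj₁ b-tight)}
      -- If all competing paths were strictly slower at this departure time, the time would witness
      -- `Needed`.
      ...   | no ∄p = contradiction
        (_ , λ p competing → decidable-stable em λ ≮ → ∄p (p , competing , ≮)) unneeded
      ...   | yes (p , (usable , avoids) , ≮) = follow p Rx E ≤-refl usable avoids
        (≤-trans (+-monoʳ-≤ _ (≮⇒≥ ≮))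
          (≤-trans (reflexive (≈-trans (⊛-arrival (weight b) (weight a) _)
                     (earliest-unique (tight-arrival a a-tight F) H))) σ≤β))

      -- The chain is rebuilt arc by arc; nonnegative weights keep the earliest arrivals along it at
      -- most `β`. The second outcome arises when `v` is entered through the overlay.
      convert : ∀ {y σ} → Reaches (Admissible (v ∷ vs) S) y → Earliest y σ → σ ≤ β →
                R′ y ⊎ (y ≡ v × IntoContracted)
      convert source _ _ = inj₁ source
      convert {y} {σ} (step {x} Rx a adm a-tight@(ρ , E , F)) H σ≤β
        with convert Rx E (≤-trans (x≤x+y (IsFIFO.nonneg (weight-isFIFO a) ρ))
               (≤-respˡ (earliest-unique H F) σ≤β)) | adm
      ... | inj₁ Rx′ | upward x∉ up a∈ = inj₁ (step Rx′ a (upward (∉vs x∉) up a∈) a-tight)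
      ... | inj₁ Rx′ | downward y∉ down y↓t a∈ =
        inj₁ (step Rx′ a (downward (∉vs y∉) down y↓t a∈) a-tight)
      ... | inj₂ (refl , _)    | upward v∉ _ _ = contradiction (here refl) v∉
      -- The downward arc out of `v` continues down to `t`, so the remembered arc into `v` is itself
      -- admissible.
      ... | inj₂ (refl , intov) | downward y∉ down y↓t a∈ =
        inj₁ (step (down-to-v intov (down ◅ y↓t)) a (downward (∉vs y∉) down y↓t a∈) a-tight)
      ... | r | inOverlay a∈ with r | x Fin.≟ v | y Fin.≟ v
      ...   | inj₁ Rx′          | no x≢v   | no y≢v   =
        inj₁ (step Rx′ a (inOverlay (retained⁺ x≢v y≢v a∈)) a-tight)
      ...   | inj₁ Rx′          | no x≢v   | yes refl = inj₂ (refl , into a a∈ x≢v Rx′ a-tight)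
      ...   | inj₁ Rx′          | yes refl | no y≢v   = inj₁ (step Rx′ a (overlay-up y≢v a∈) a-tight)
      -- A loop at `v` is dropped, here and in the next case.
      ...   | inj₁ Rx′          | yes refl | yes refl = inj₁ Rx′
      ...   | inj₂ (refl , intov) | _        | yes refl = inj₂ (refl , intov)
      ...   | inj₂ (refl , intov) | _        | no y≢v   = inj₁ (bypass intov a a∈ y≢v a-tight H σ≤β)

    -- Induction on the earliest arrival. If the rebuilt chain ends by entering `v`, then `w` is not
    -- in `vs`, so `t` lies below `v` and the last arc is kept as a downward arc.
    contract-reaches : ∀ {w} → Acc _⊏_ w → Path s w → w ∈ vs ⊎ Star Down w t → R′ w
    contract-reaches {w} (acc rs) q w∈ with reaches q ([ inj₁ ∘ there , inj₂ ]′ w∈)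
    ... | Rw with reaches-earliest Rw
    ...   | β , F with convert β (λ z∈ E σ<β → contract-reaches (rs (_ , _ , E , F , σ<β))
                                               (proj₁ (attained E)) (inj₁ z∈)) Rw F ≤-refl
    ...     | inj₁ Rw′ = Rw′
    ...     | inj₂ (refl , intov) = [ (λ v∈ → contradiction v∈ v∉vs) , down-to-v intov ]′ w∈

    contract-invariant : Invariant vs contract
    contract-invariant = record
      { overlay-vertices  = contract-vertices
      ; overlay⊆hierarchy = contract-overlay⊆hierarchy
      ; reaches           = contract-reaches (⊏-wellFounded _)
      }

  -- The equation ties the current stage to `final`: admissibility speaks of the finished hierarchy,
  -- which has to contain the current one.
  contractAll-invariant : ∀ vs S → AllPairs (λ v w → rank v Fin.< rank w) vs →
    contractAll vs S ≡ final → Invariant vs S → Invariant [] final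
  contractAll-invariant []       S _ refl inv = inv
  contractAll-invariant (v ∷ vs) S (v-lowest ∷ sorted) eq inv =
    contractAll-invariant vs (Contraction.contract S v) sorted eq
      (ContractionStep.contract-invariant v vs S v-lowest inv
        (λ {x} {y} a∈ → subst (λ S → _ ∈ hierarchy S x y) eq (hierarchy⊆contractAll (v ∷ vs) S a∈)))

  final-invariant : Invariant [] final
  final-invariant = contractAll-invariant (tabulate (order ⟨$⟩ʳ_)) initial
    (AllPairs.tabulate⁺-< λ {i} {j} i<j →
      ≡.subst₂ Fin._<_ (≡.sym (inverseˡ order)) (≡.sym (inverseˡ order)) i<j)
    refl
    (initial-invariant λ v → subst (_∈ _) (inverseʳ order) (∈-tabulate⁺ (rank v)))

  searched : ∀ {x y} → Arc x y → Set
  searched {x} {y} a = a ∈ searchArcs t x y × a ∈ TCH x y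

  -- The invariant still covers `t` after all contractions, since `ε` leads from `t` down to itself.
  target-reached : Path s t → Reaches searched t
  target-reached q = reaches-map admissible⇒searched (reaches q (inj₂ ε))
    where
    open Invariant final-invariant
    admissible⇒searched : ∀ {x y} {a : Arc x y} → Admissible [] final a → searched a
    admissible⇒searched (inOverlay a∈) with () ← proj₁ (overlay-vertices a∈)
    admissible⇒searched {x} {y} (upward _ up a∈) with em {Up x y ⊎ Marked t x y}
    ... | yes _  = a∈ , a∈
    ... | no ¬um = contradiction (inj₁ up) ¬um
    admissible⇒searched {x} {y} (downward _ down y↓t a∈) with em {Up x y ⊎ Marked t x y}
    ... | yes _  = a∈ , a∈
    ... | no ¬um = contradiction (inj₂ (down , down ◅ y↓t , y↓t)) ¬um

  -- Exactness of Dijkstra's algorithm at tightly reached nodes.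

  module Search where
    open Dijkstra (searchArcs t) s τ₀

    -- A missing label counts as an infinite arrival time, so a bound also asserts that a label
    -- exists.
    _≼_ : ∀ {v} → Maybe (Label v) → Time → Set
    nothing ≼ τ = ⊥
    just l  ≼ τ = arrival l ≤ τ

    ≼-trans : ∀ {v} (m : Maybe (Label v)) {σ τ} → m ≼ σ → σ ≤ τ → m ≼ τ
    ≼-trans (just l) = ≤-trans

    Sound : ∀ {v} → Label v → Set
    Sound l = τ₀ + pathTime weight (path l) τ₀ ≈ arrival l

    sound-travel : ∀ {v} {l : Label v} → Sound l → τ₀ + travel (represented (path l)) τ₀ ≈ arrival l
    sound-travel {l = l} sound = ≈-trans (+-congˡ (travel-represented (path l) τ₀)) sound

    sound-earliest : ∀ {v σ} {l : Label v} → Sound l → Earliest v σ → arrival l ≤ σ →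
                     σ ≈ arrival l
    sound-earliest {l = l} sound E l≤σ =
      antisym (≤-respʳ (sound-travel {l = l} sound) (minimal E (represented (path l)))) l≤σ

    better-new : ∀ {v} (l : Label v) m → arrival (better l m) ≤ arrival l
    better-new l nothing    = ≤-refl
    better-new l (just old) with em {arrival l < arrival old}
    ... | yes _ = ≤-refl
    ... | no  ≮ = ≮⇒≥ ≮

    better-old : ∀ {v} (l : Label v) m {τ} → m ≼ τ → arrival (better l m) ≤ τ
    better-old l (just old) old≤τ with em {arrival l < arrival old}
    ... | yes (l≤old , _) = ≤-trans l≤old old≤τ
    ... | no  _           = old≤τ

    better-sound : ∀ {v} (l : Label v) m → Sound l → Maybe.All Sound m → Sound (better l m)
    better-sound l nothing    l-sound _                      = l-sound
    better-sound l (just old) l-sound (Maybe.just old-sound) with em {arrival l < arrival old}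
    ... | yes _ = l-sound
    ... | no  _ = old-sound

    module _ {u w : V} (lu : Label u) where

      relax-old : ∀ (m : Maybe (Label w)) a {τ} → m ≼ τ → relax lu m a ≼ τ
      relax-old m a m≼τ with em {Active a (arrival lu)}
      ... | yes _ = better-old _ m m≼τ
      ... | no  _ = m≼τ

      relax-new : ∀ (m : Maybe (Label w)) a → Active a (arrival lu) →
                  relax lu m a ≼ (arrival lu + weight a (arrival lu))
      relax-new m a act with em {Active a (arrival lu)}
      ... | yes _   = better-new _ m
      ... | no ¬act = contradiction act ¬act

      relax-sound : ∀ (m : Maybe (Label w)) a → Sound lu → Maybe.All Sound m →
                    Maybe.All Sound (relax lu m a)
      relax-sound m a lu-sound m-sound with em {Active a (arrival lu)}
      ... | no  _ = m-sound
      ... | yes _ = Maybe.just (better-sound _ m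
        (≈-trans (arrival-◅◅ weight-isFIFO (path lu) (a ◅ ε) τ₀)
          (≈-trans (IsFIFO.arrival-cong (pathTime-isFIFO {A = Arc} weight-isFIFO (a ◅ ε)) lu-sound)
            (+-congˡ (+-identityʳ _))))
        m-sound)

      relaxList-old : ∀ as (m : Maybe (Label w)) {τ} → m ≼ τ → foldl (relax lu) m as ≼ τ
      relaxList-old []       m m≼τ = m≼τ
      relaxList-old (a ∷ as) m m≼τ = relaxList-old as (relax lu m a) (relax-old m a m≼τ)

      relaxList-new : ∀ as (m : Maybe (Label w)) {a} → a ∈ as → Active a (arrival lu) →
                      foldl (relax lu) m as ≼ (arrival lu + weight a (arrival lu))
      relaxList-new (a ∷ as) m (here refl) act =
        relaxList-old as (relax lu m a) (relax-new m a act)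
      relaxList-new (a ∷ as) m (there a∈)  act = relaxList-new as (relax lu m a) a∈ act

      relaxList-sound : ∀ as (m : Maybe (Label w)) → Sound lu → Maybe.All Sound m →
                        Maybe.All Sound (foldl (relax lu) m as)
      relaxList-sound []       m lu-sound m-sound = m-sound
      relaxList-sound (a ∷ as) m lu-sound m-sound =
        relaxList-sound as (relax lu m a) lu-sound (relax-sound m a lu-sound m-sound)

    closest-nothing : ∀ ls vs → closest ls vs ≡ nothing → ∀ {v τ} → v ∈ vs → ¬ ls v ≼ τ
    closest-nothing ls (v ∷ vs) eq v∈ v≼ with ls v in lsv | closest ls vs in rest
    closest-nothing ls (v ∷ vs) eq (here refl) v≼ | nothing | nothing rewrite lsv = v≼
    closest-nothing ls (v ∷ vs) eq (there v∈)  v≼ | nothing | nothing =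
      closest-nothing ls vs rest v∈ v≼
    closest-nothing ls (v ∷ vs) eq v∈ v≼ | just l | just (v′ , l′) with em {arrival l ≤ arrival l′}
    closest-nothing ls (v ∷ vs) () v∈ v≼ | just l | just (v′ , l′) | yes _
    closest-nothing ls (v ∷ vs) () v∈ v≼ | just l | just (v′ , l′) | no _

    IsClosest : Labels → List V → (u : V) → Label u → Set
    IsClosest ls vs u l = u ∈ vs × ls u ≡ just l × (∀ {v τ} → v ∈ vs → ls v ≼ τ → arrival l ≤ τ)

    closest-just : ∀ ls vs {u l} → closest ls vs ≡ just (u , l) → IsClosest ls vs u l
    closest-just ls (v ∷ vs) eq with ls v in lsv | closest ls vs in rest
    closest-just ls (v ∷ vs) refl | nothing | just (u , l) with closest-just ls vs rest
    ... | u∈ , lsu , l≤ = there u∈ , lsu , λ where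
      (here refl) v≼ → ⊥-elim (subst (_≼ _) lsv v≼)
      (there w∈)  w≼ → l≤ w∈ w≼
    closest-just ls (v ∷ vs) refl | just l | nothing = here refl , lsv , λ where
      (here refl) v≼ → subst (_≼ _) lsv v≼
      (there w∈)  w≼ → contradiction w≼ (closest-nothing ls vs rest w∈)
    closest-just ls (v ∷ vs) eq | just l | just (v′ , l′)
      with em {arrival l ≤ arrival l′} | closest-just ls vs rest
    closest-just ls (v ∷ vs) refl | just l | just (v′ , l′) | yes l≤l′ | _ , _ , l′≤ =
      here refl , lsv , λ where
        (here refl) v≼ → subst (_≼ _) lsv v≼
        (there w∈)  w≼ → ≤-trans l≤l′ (l′≤ w∈ w≼)
    closest-just ls (v ∷ vs) refl | just l | just (v′ , l′) | no l≰l′ | v′∈ , lsv′ , l′≤ =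
      there v′∈ , lsv′ , λ where
        (here refl) v≼ → ≤-trans (≰⇒≥ l≰l′) (subst (_≼ _) lsv v≼)
        (there w∈)  w≼ → l′≤ w∈ w≼

    Reached : V → Set
    Reached = Reaches searched

    -- `U` holds the unsettled nodes. Exactness is claimed only at nodes reached by tight search
    -- arcs; elsewhere activity may interfere and labels are merely sound. Upper bounds suffice,
    -- since sound labels never undercut earliest arrivals.
    record SearchInvariant (U : List V) (ls : Labels) : Set where
      field
        sound   : ∀ v → Maybe.All Sound (ls v)
        start≼  : ls s ≼ τ₀
        settled : ∀ {v σ} → v ∉ U → Reached v → Earliest v σ → ls v ≼ σ
        relaxed : ∀ {v y σ} (a : Arc v y) → v ∉ U → Reached v → searched a → Tight a →
                  Earliest v σ → ls y ≼ (σ + weight a σ)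

    start-invariant : SearchInvariant (allFin size) start
    start-invariant = record
      { sound   = start-sound
      ; start≼  = start-source refl
      ; settled = λ {v} v∉ → contradiction (∈-allFin v) v∉
      ; relaxed = λ {v} a v∉ → contradiction (∈-allFin v) v∉
      }
      where
      start-sound : ∀ v → Maybe.All Sound (start v)
      start-sound v with s Fin.≟ v
      ... | yes refl = Maybe.just (+-identityʳ τ₀)
      ... | no  _    = Maybe.nothing

      start-source : ∀ {v} → s ≡ v → start v ≼ τ₀
      start-source {v} s≡v with s Fin.≟ v
      ... | yes refl = ≤-refl
      ... | no  s≢v  = contradiction s≡v s≢v

    -- Going back along the tight chain from `u`, one stops at `s` or at a node with settled
    -- predecessor, whose label is bounded by its earliest arrival and hence by `σ`. All nodes
    -- passed on the way, `u` possibly excepted, are unsettled.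
    frontier : ∀ {U ls} → SearchInvariant U ls → ∀ {u σ} → Reached u → Earliest u σ →
               ∃[ x ] (x ≡ u ⊎ x ∈ U) × ls x ≼ σ
    frontier {ls = ls} inv source E =
      s , inj₁ refl , ≼-trans (ls s) start≼ (reflexive (earliest-unique earliest-source E))
      where open SearchInvariant inv
    frontier {U} {ls} inv {u} {σ} (step {x} Rx a a∈ a-tight@(ρ , E , F)) H with em {x ∈ U}
    ... | no x∉U = u , inj₁ refl ,
      ≼-trans (ls u) (SearchInvariant.relaxed inv a x∉U Rx a∈ a-tight E)
        (reflexive (earliest-unique F H))
    ... | yes x∈U with frontier inv Rx E
    ...   | x′ , x′∈ , x′≼ = x′ , inj₂ ([ (λ { refl → x∈U }) , id ]′ x′∈) ,
      ≼-trans (ls x′) x′≼ (≤-trans (x≤x+y (IsFIFO.nonneg (weight-isFIFO a) ρ))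
        (reflexive (earliest-unique F H)))

    without : V → List V → List V
    without u = filter (λ v → ¬? (v Fin.≟ u))

    settle-invariant : ∀ {U ls u lu} → SearchInvariant U ls → IsClosest ls U u lu →
                       SearchInvariant (without u U) (relaxAll lu ls)
    settle-invariant {U} {ls} {u} {lu} inv (u∈ , lsu , lu≤) = record
      { sound   = λ w → relaxList-sound lu (searchArcs t u w) (ls w) lu-sound (sound w)
      ; start≼  = keep start≼
      ; settled = settled′
      ; relaxed = relaxed′
      }
      where
      open SearchInvariant inv

      lu-sound : Sound lu
      lu-sound with subst (Maybe.All Sound) lsu (sound u)
      ... | Maybe.just p = p

      keep : ∀ {w τ} → ls w ≼ τ → relaxAll lu ls w ≼ τ
      keep {w} = relaxList-old lu (searchArcs t u w) (ls w)

      -- `lu` is minimal among the unsettled labels, and `frontier` exhibits one of these that is no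
      -- later than `σ`.
      lu-earliest : ∀ {σ} → Reached u → Earliest u σ → arrival lu ≤ σ
      lu-earliest Ru E with frontier inv Ru E
      ... | x , x∈ , x≼ = lu≤ ([ (λ { refl → u∈ }) , id ]′ x∈) x≼

      ∉U : ∀ {v} → v ≢ u → v ∉ without u U → v ∉ U
      ∉U v≢u v∉ v∈ = v∉ (∈-filter⁺ (λ v → ¬? (v Fin.≟ u)) v∈ v≢u)

      settled′ : ∀ {v σ} → v ∉ without u U → Reached v → Earliest v σ → relaxAll lu ls v ≼ σ
      settled′ {v} v∉ Rv E with v Fin.≟ u
      ... | yes refl = keep (subst (_≼ _) (≡.sym lsu) (lu-earliest Rv E))
      ... | no v≢u   = keep (settled (∉U v≢u v∉) Rv E)

      relaxed′ : ∀ {v y σ} (a : Arc v y) → v ∉ without u U → Reached v → searched a → Tight a →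
                 Earliest v σ → relaxAll lu ls y ≼ (σ + weight a σ)
      relaxed′ {v} {y} a v∉ Rv a∈ a-tight E with v Fin.≟ u
      ... | no v≢u   = keep (relaxed a (∉U v≢u v∉) Rv a∈ a-tight E)
      ... | yes refl = ≼-trans (relaxAll lu ls y)
        (relaxList-new lu (searchArcs t u y) (ls y) (proj₁ a∈)
          -- The label being settled is exact, so the arc is evaluated at the earliest arrival at
          -- its tail; there tightness makes it optimal, hence active.
          (optimal⇒active (proj₂ a∈) (tight-optimal a a-tight (earliest-resp-≈ σ≈lu E))))
        (reflexive (IsFIFO.arrival-cong (weight-isFIFO a) (≈-sym σ≈lu)))
        where
        σ≈lu = sound-earliest {l = lu} lu-sound E (lu-earliest Rv E)

    Final : Labels → Set
    Final ls = (∀ v → Maybe.All Sound (ls v)) ×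
               (∀ {v σ} → Reached v → Earliest v σ → ls v ≼ σ)

    -- When no unsettled node has a label, the label found by `frontier` must be that of the node
    -- itself.
    final-labels : ∀ {U ls} → SearchInvariant U ls → (∀ {v τ} → v ∈ U → ¬ ls v ≼ τ) → Final ls
    final-labels {U} {ls} inv unlabelled = SearchInvariant.sound inv , labelled
      where
      labelled : ∀ {v σ} → Reached v → Earliest v σ → ls v ≼ σ
      labelled Rv E with frontier inv Rv E
      ... | x , inj₁ refl , x≼ = x≼
      ... | x , inj₂ x∈   , x≼ = contradiction x≼ (unlabelled x∈)

    run-final : ∀ k U ls → length U ℕ.≤ k → SearchInvariant U ls → Final (run k U ls)
    -- With no rounds left, the length bound leaves only the empty queue.
    run-final zero    []       ls _ inv = final-labels inv λ ()
    run-final (suc k) U        ls len inv with closest ls U in eq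
    ... | nothing       = final-labels inv (closest-nothing ls U eq)
    ... | just (u , lu) with closest-just ls U eq
    ...   | isClosest@(u∈ , _) = run-final k (without u U) (relaxAll lu ls)
      -- The queue strictly shrinks, because `u` belongs to it and is filtered out.
      (ℕ.≤-pred (ℕ.≤-trans (filter-notAll (λ v → ¬? (v Fin.≟ u)) U
        (Any.map (λ { refl u≢u → u≢u refl }) u∈)) len))
      (settle-invariant inv isClosest)

    search-shortest : Path s t → ∃[ p ] search t ≡ just p × IsShortestAt τ₀ (represented p)
    search-shortest q with target-reached q
    ... | Rt with reaches-earliest Rt
    ...   | σ , E with run-final size (allFin size) start (ℕ.≤-reflexive (length-tabulate id)) start-invariant
    ...     | sound , labelled with run size (allFin size) start t | sound t | labelled Rt E
    -- The bound at `t` rules out a missing label; cancelling `τ₀` turns arrivals into travel times.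
    ...       | just l | Maybe.just l-sound | l≤σ = path l , refl , λ r →
      +-cancelˡ-≤ τ₀ (≤-respˡ (≈-sym (sound-travel {l = l} l-sound)) (≤-trans l≤σ (minimal E r)))

theorem1 : (em : ExcludedMiddle 0ℓ) (ℝ : Reals) (G : TimeDependentNetwork ℝ)
    (order : Permutation′ (TimeDependentNetwork.size G)) →
    let open Hierarchy em ℝ G order in
    (s t : V) (τ₀ : Time) → Path s t →
    ∃[ p ] query s t τ₀ ≡ just p × IsShortestAt τ₀ (represented p)
theorem1 em ℝ G order s t τ₀ = Contracting.Search.search-shortest em ℝ G order s t τ₀
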